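{- (Soundness.) If $\Delta;\Gamma\vdash t:A$ is derivable in $\lambda_{\mathrm{MELL}}$, then $\vdash{?}\Delta^\perp,\Gamma^\perp,A$ is derivable in MELL, where ${?}\Delta^\perp$ is the multiset of the formulae ${?}(B^\perp)$ for $u:B$ in $\Delta$, and $\Gamma^\perp$ is the multiset of the formulae $B^\perp$ for $a:B$ in $\Gamma$. (Completeness.) If $\vdash\Gamma_0$ is derivable in MELL and $\Gamma,A$ is any permutation of $\Gamma_0$ (with $\Gamma=A_1,\dots,A_n$), then there exists a term $t$ such that $\cdot\,;a_1:A_1^\perp,\dots,a_n:A_n^\perp\vdash t:A$ is derivable in $\lambda_{\mathrm{MELL}}$, where $a_1,\dots,a_n$ are distinct linear variables and $\cdot$ is the empty unrestricted environment.
   Context: MELL formulae: $A,B::=\alpha\mid\overline\alpha\mid A\otimes B\mid A\wp B\mid\mathbf 1\mid\bot\mid{!}A\mid{?}A$, where $\alpha$ ranges over atomic formulae, $\overline\alpha$ is its negative version and $\wp$ is multiplicative disjunction ("par"). Linear negation is the involution $\alpha^\perp=\overline\alpha$, $\overline\alpha^\perp=\alpha$, $(A\otimes B)^\perp=A^\perp\wp B^\perp$, $(A\wp B)^\perp=A^\perp\otimes B^\perp$, $\mathbf1^\perp=\bot$, $\bot^\perp=\mathbf1$, $({!}A)^\perp={?}(A^\perp)$, $({?}A)^\perp={!}(A^\perp)$. MELL sequents $\vdash\Gamma$, $\Gamma$ a finite multiset of formulae, are derived by the rules (premises $\Rightarrow$ conclusion): (ax) $\Rightarrow\ \vdash A,A^\perp$;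 (cut) $\vdash\Gamma,A$ and $\vdash\Gamma',A^\perp$ $\Rightarrow$ $\vdash\Gamma,\Gamma'$; ($\otimes$) $\vdash\Gamma,A$ and $\vdash\Gamma',B$ $\Rightarrow$ $\vdash\Gamma,\Gamma',A\otimes B$; ($\wp$) $\vdash\Gamma,A,B$ $\Rightarrow$ $\vdash\Gamma,A\wp B$; ($\mathbf1$) $\Rightarrow\ \vdash\mathbf1$; ($\bot$) $\vdash\Gamma$ $\Rightarrow$ $\vdash\Gamma,\bot$; (promotion) $\vdash{?}\Gamma,A$ $\Rightarrow$ $\vdash{?}\Gamma,{!}A$; (weakening) $\vdash\Gamma$ $\Rightarrow$ $\vdash\Gamma,{?}A$; (dereliction) $\vdash\Gamma,A$ $\Rightarrow$ $\vdash\Gamma,{?}A$; (contraction) $\vdash\Gamma,{?}A,{?}A$ $\Rightarrow$ $\vdash\Gamma,{?}A$. Terms of $\lambda_{\mathrm{MELL}}$, over linear variables $a,b,c,\dots$ and unrestricted variables $u,v,\dots$: $t,s::=a\mid u\mid\langle t,s\rangle\mid t[\langle a,b\rangle:=s]\mid\wp(a,b).t\mid t\bullet s\mid t\blacktriangledown s\mid{!}a.t\mid t[{!}u:=s]\mid{?}u.t\mid t\blacktriangleright^{a}s\mid t\,\sharp\,s\mid\star\mid t[\star:=s]$. Binding: $t[\langle a,b\rangle:=s]$ and $\wp(a,b).t$ bind $a,b$ in $t$; ${!}a.t$ and $t\blacktriangleright^a s$ bind $a$ in $t$; $t[{!}u:=s]$ and ${?}u.t$ bind $u$ in $t$. Terms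 are taken up to $\alpha$-renaming. Typing judgements $\Delta;\Gamma\vdash t:A$, where $\Delta$ (resp. $\Gamma$) is a finite partial function from unrestricted (resp. linear) variables to formulae; $\Gamma,\Gamma'$ denotes union with disjoint domains. Typing rules: $\Rightarrow\Delta;a:A\vdash a:A$; $\Rightarrow\Delta,u:A;\cdot\vdash u:A$; $\Delta;\Gamma\vdash t:A$ and $\Delta;\Gamma'\vdash s:B$ $\Rightarrow$ $\Delta;\Gamma,\Gamma'\vdash\langle t,s\rangle:A\otimes B$; $\Delta;\Gamma\vdash s:A\otimes B$ and $\Delta;\Gamma',a:A,b:B\vdash t:C$ $\Rightarrow$ $\Delta;\Gamma,\Gamma'\vdash t[\langle a,b\rangle:=s]:C$; $\Delta;\Gamma,a:A,b:B\vdash t:\bot$ $\Rightarrow$ $\Delta;\Gamma\vdash\wp(a,b).t:A^\perp\wp B^\perp$; $\Delta;\Gamma\vdash t:A\wp B$ and $\Delta;\Gamma'\vdash s:A^\perp$ $\Rightarrow$ $\Delta;\Gamma,\Gamma'\vdash t\bullet s:B$; $\Delta;\Gamma\vdash t:A\wp B$ and $\Delta;\Gamma'\vdash s:B^\perp$ $\Rightarrow$ $\Delta;\Gamma,\Gamma'\vdash t\blacktriangledown s:A$; $\Delta;a:A\vdash t:\bot$ $\Rightarrow$ $\Delta;\cdot\vdash{!}a.t:{!}(A^\perp)$; $\Delta;\Gamma\vdash s:{!}A$ and $\Delta,u:A;\Gamma'\vdash t:B$ $\Rightarrow$ $\Delta;\Gamma,\Gamma'\vdash t[{!}u:=s]:B$;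 $\Delta,u:A^\perp;\Gamma\vdash t:\bot$ $\Rightarrow$ $\Delta;\Gamma\vdash{?}u.t:{?}A$; $\Delta;\Gamma\vdash s:{?}A$ and $\Delta;a:A\vdash t:\bot$ $\Rightarrow$ $\Delta;\Gamma\vdash t\blacktriangleright^a s:\bot$; $\Delta;\Gamma\vdash t:B$ and $\Delta;\Gamma'\vdash s:B^\perp$ $\Rightarrow$ $\Delta;\Gamma,\Gamma'\vdash t\,\sharp\,s:\bot$; $\Rightarrow\Delta;\cdot\vdash\star:\mathbf1$; $\Delta;\Gamma\vdash s:\mathbf1$ and $\Delta;\Gamma'\vdash t:A$ $\Rightarrow$ $\Delta;\Gamma,\Gamma'\vdash t[\star:=s]:A$. -}

module Defs where

open import Data.Fin using (Fin; fromℕ; inject₁)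
open import Data.List using (List; []; _∷_; _++_; map)
open import Data.List.Membership.Propositional using (_∈_)
open import Data.List.Relation.Binary.Permutation.Propositional using (_↭_)
open import Data.List.Relation.Unary.Unique.Propositional using (Unique; []; _∷_)
open import Data.List.Relation.Unary.All using ([])
open import Data.Nat using (ℕ; suc; _≟_)
open import Data.Product using (_×_; _,_; proj₁; proj₂)
open import Data.Vec using (Vec; toList; zip)
open import Data.Vec.Properties using (toList-map; map-proj₁-zip)
open import Relation.Binary.PropositionalEquality
  using (_≡_; sym; trans; cong; subst)
open import Relation.Nullary using (yes; no)

infix  30 _⊥
infix  25 ‼_ ⁇_
infixr 22 _⊗_ _⅋_

-- ‼ and ⁇ stand for the exponentials ! and ? (a lone ? is an Agda hole).
data Formula (At : Set) : Set where
  atom natom : At → Formula At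
  _⊗_ _⅋_    : Formula At → Formula At → Formula At
  𝟏 𝐛𝐨𝐭       : Formula At
  ‼_ ⁇_      : Formula At → Formula At

_⊥ : {At : Set} → Formula At → Formula At
(atom α)  ⊥ = natom α
(natom α) ⊥ = atom α
(A ⊗ B)   ⊥ = A ⊥ ⅋ B ⊥
(A ⅋ B)   ⊥ = A ⊥ ⊗ B ⊥
𝟏         ⊥ = 𝐛𝐨𝐭
𝐛𝐨𝐭       ⊥ = 𝟏
(‼ A)     ⊥ = ⁇ (A ⊥)
(⁇ A)     ⊥ = ‼ (A ⊥)

-- Sequents are finite multisets, represented by lists; the rule `exch`
-- identifies lists that are permutations of each other.
infix 4 ⊢_

data ⊢_ {At : Set} : List (Formula At) → Set where
  exch          : ∀ {Γ Γ′} → Γ ↭ Γ′ → ⊢ Γ → ⊢ Γ′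
  ax            : ∀ {A} → ⊢ A ∷ A ⊥ ∷ []
  cut           : ∀ {Γ Γ′ A} → ⊢ A ∷ Γ → ⊢ A ⊥ ∷ Γ′ → ⊢ Γ ++ Γ′
  tensor        : ∀ {Γ Γ′ A B} → ⊢ A ∷ Γ → ⊢ B ∷ Γ′ → ⊢ A ⊗ B ∷ Γ ++ Γ′
  par           : ∀ {Γ A B} → ⊢ A ∷ B ∷ Γ → ⊢ A ⅋ B ∷ Γ
  one           : ⊢ 𝟏 ∷ []
  bottom        : ∀ {Γ} → ⊢ Γ → ⊢ 𝐛𝐨𝐭 ∷ Γ
  promotion     : ∀ {Γ A} → ⊢ A ∷ map ⁇_ Γ → ⊢ ‼ A ∷ map ⁇_ Γ
  weakening     : ∀ {Γ A} → ⊢ Γ → ⊢ ⁇ A ∷ Γ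
  dereliction   : ∀ {Γ A} → ⊢ A ∷ Γ → ⊢ ⁇ A ∷ Γ
  contraction   : ∀ {Γ A} → ⊢ ⁇ A ∷ ⁇ A ∷ Γ → ⊢ ⁇ A ∷ Γ

-- Two disjoint sorts of variables: a linear and an unrestricted variable are
-- never confused, since they enter terms through different constructors and
-- environments through different components of the judgement.
LVar UVar : Set
LVar = ℕ
UVar = ℕ

-- Terms up to α-renaming, in locally nameless form: free variables are names,
-- bound ones are de Bruijn indices, with separate indices for the two sorts.
-- `Pre l m` has l dangling linear and m dangling unrestricted indices, so that
-- `Term` is exactly the set of α-equivalence classes of terms.
data Pre (l m : ℕ) : Set where
  lfree   : LVar → Pre l m
  lbound  : Fin l → Pre l m
  ufree   : UVar → Pre l m
  ubound  : Fin m → Pre l m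
  pair    : Pre l m → Pre l m → Pre l m
  letpair : Pre (suc (suc l)) m → Pre l m → Pre l m
  parabs  : Pre (suc (suc l)) m → Pre l m
  appˡ    : Pre l m → Pre l m → Pre l m
  appʳ    : Pre l m → Pre l m → Pre l m
  bang    : Pre (suc l) m → Pre l m
  letbang : Pre l (suc m) → Pre l m → Pre l m
  whynot  : Pre l (suc m) → Pre l m
  linsub  : Pre (suc l) m → Pre l m → Pre l m
  contra  : Pre l m → Pre l m → Pre l m
  star    : Pre l m
  letstar : Pre l m → Pre l m → Pre l m

Term : Set
Term = Pre 0 0

-- Abstraction of a free name into a new outermost index; the indices already
-- present keep their value, so the new one is the largest.
closeˡ : ∀ {l m} → LVar → Pre l m → Pre (suc l) m
closeˡ {l} a (lfree b) with a ≟ b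
... | yes _ = lbound (fromℕ l)
... | no  _ = lfree b
closeˡ a (lbound i)    = lbound (inject₁ i)
closeˡ a (ufree u)     = ufree u
closeˡ a (ubound i)    = ubound i
closeˡ a (pair t s)    = pair (closeˡ a t) (closeˡ a s)
closeˡ a (letpair t s) = letpair (closeˡ a t) (closeˡ a s)
closeˡ a (parabs t)    = parabs (closeˡ a t)
closeˡ a (appˡ t s)    = appˡ (closeˡ a t) (closeˡ a s)
closeˡ a (appʳ t s)    = appʳ (closeˡ a t) (closeˡ a s)
closeˡ a (bang t)      = bang (closeˡ a t)
closeˡ a (letbang t s) = letbang (closeˡ a t) (closeˡ a s)
closeˡ a (whynot t)    = whynot (closeˡ a t)
closeˡ a (linsub t s)  = linsub (closeˡ a t) (closeˡ a s)
closeˡ a (contra t s)  = contra (closeˡ a t) (closeˡ a s)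
closeˡ a star          = star
closeˡ a (letstar t s) = letstar (closeˡ a t) (closeˡ a s)

closeᵘ : ∀ {l m} → UVar → Pre l m → Pre l (suc m)
closeᵘ {m = m} u (ufree v) with u ≟ v
... | yes _ = ubound (fromℕ m)
... | no  _ = ufree v
closeᵘ u (ubound i)    = ubound (inject₁ i)
closeᵘ u (lfree a)     = lfree a
closeᵘ u (lbound i)    = lbound i
closeᵘ u (pair t s)    = pair (closeᵘ u t) (closeᵘ u s)
closeᵘ u (letpair t s) = letpair (closeᵘ u t) (closeᵘ u s)
closeᵘ u (parabs t)    = parabs (closeᵘ u t)
closeᵘ u (appˡ t s)    = appˡ (closeᵘ u t) (closeᵘ u s)
closeᵘ u (appʳ t s)    = appʳ (closeᵘ u t) (closeᵘ u s)
closeᵘ u (bang t)      = bang (closeᵘ u t)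
closeᵘ u (letbang t s) = letbang (closeᵘ u t) (closeᵘ u s)
closeᵘ u (whynot t)    = whynot (closeᵘ u t)
closeᵘ u (linsub t s)  = linsub (closeᵘ u t) (closeᵘ u s)
closeᵘ u (contra t s)  = contra (closeᵘ u t) (closeᵘ u s)
closeᵘ u star          = star
closeᵘ u (letstar t s) = letstar (closeᵘ u t) (closeᵘ u s)

-- The named syntax, as operations on α-classes. The two names of a pair
-- binder are always distinct in a typed term.
infix 15 _[⟨_,_⟩≔_] _[!_≔_] _[⋆≔_]
infix 12 _•_ _▾_ _▶⟨_⟩_ _♯_
infix 10 ℘⟨_,_⟩_ !⟨_⟩_ ?⟨_⟩_

⟨_,_⟩ : Term → Term → Term
⟨ t , s ⟩ = pair t s

_[⟨_,_⟩≔_] : Term → LVar → LVar → Term → Term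
t [⟨ a , b ⟩≔ s ] = letpair (closeˡ a (closeˡ b t)) s

℘⟨_,_⟩_ : LVar → LVar → Term → Term
℘⟨ a , b ⟩ t = parabs (closeˡ a (closeˡ b t))

_•_ : Term → Term → Term
t • s = appˡ t s

_▾_ : Term → Term → Term
t ▾ s = appʳ t s

!⟨_⟩_ : LVar → Term → Term
!⟨ a ⟩ t = bang (closeˡ a t)

_[!_≔_] : Term → UVar → Term → Term
t [! u ≔ s ] = letbang (closeᵘ u t) s

?⟨_⟩_ : UVar → Term → Term
?⟨ u ⟩ t = whynot (closeᵘ u t)

_▶⟨_⟩_ : Term → LVar → Term → Term
t ▶⟨ a ⟩ s = linsub (closeˡ a t) s

_♯_ : Term → Term → Term
t ♯ s = contra t s

⋆ : Term
⋆ = star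

_[⋆≔_] : Term → Term → Term
t [⋆≔ s ] = letstar t s

-- Finite partial functions from variables to formulae, as graphs listed
-- without repetition. Two environments are the same function when their
-- bindings are permutations of each other, hence the uses of ↭ below.
record Env (V At : Set) : Set where
  constructor env
  field
    bindings : List (V × Formula At)
    distinct : Unique (map proj₁ bindings)

open Env public

formulae : ∀ {V At} → Env V At → List (Formula At)
formulae Γ = map proj₂ (bindings Γ)

∅ : ∀ {V At} → Env V At
∅ = env [] []

[_⦂_] : ∀ {V At} → V → Formula At → Env V At
[ x ⦂ A ] = env ((x , A) ∷ []) ([] ∷ [])

zip-names : ∀ {X Y : Set} {n} (xs : Vec X n) (ys : Vec Y n) →
            map proj₁ (toList (zip xs ys)) ≡ toList xs
zip-names xs ys = trans (sym (toList-map proj₁ (zip xs ys)))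
                        (cong toList (map-proj₁-zip xs ys))

-- x₁ : A₁ , … , xₙ : Aₙ
declare : ∀ {V At n} (xs : Vec V n) → Unique (toList xs) → Vec (Formula At) n → Env V At
declare xs u As = env (toList (zip xs As)) (subst Unique (sym (zip-names xs As)) u)

-- Γ₀ ≐ Γ , Γ′ ; since Γ₀ is an environment, the domains of Γ and Γ′ are
-- disjoint.
infix 4 _≐_⊎_ _≐_,_⦂_ _≐_,_⦂_,_⦂_

_≐_⊎_ : ∀ {V At} → Env V At → Env V At → Env V At → Set
Γ₀ ≐ Γ ⊎ Γ′ = bindings Γ₀ ↭ bindings Γ ++ bindings Γ′

_≐_,_⦂_ : ∀ {V At} → Env V At → Env V At → V → Formula At → Set
Γ₀ ≐ Γ , x ⦂ A = bindings Γ₀ ↭ (x , A) ∷ bindings Γ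

_≐_,_⦂_,_⦂_ : ∀ {V At} → Env V At → Env V At → V → Formula At → V → Formula At → Set
Γ₀ ≐ Γ , x ⦂ A , y ⦂ B = bindings Γ₀ ↭ (x , A) ∷ (y , B) ∷ bindings Γ

infix 4 _⨾_⊢_⦂_

data _⨾_⊢_⦂_ {At : Set} (Δ : Env UVar At) : Env LVar At → Term → Formula At → Set where
  ⊢lvar : ∀ {a A} →
    Δ ⨾ [ a ⦂ A ] ⊢ lfree a ⦂ A

  ⊢uvar : ∀ {u A} →
    (u , A) ∈ bindings Δ →
    Δ ⨾ ∅ ⊢ ufree u ⦂ A

  ⊢pair : ∀ {Γ₀ Γ Γ′ t s A B} →
    Γ₀ ≐ Γ ⊎ Γ′ →
    Δ ⨾ Γ ⊢ t ⦂ A →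
    Δ ⨾ Γ′ ⊢ s ⦂ B →
    Δ ⨾ Γ₀ ⊢ ⟨ t , s ⟩ ⦂ A ⊗ B

  ⊢letpair : ∀ {Γ₀ Γ Γ′ Γ″ t s a b A B C} →
    Γ₀ ≐ Γ ⊎ Γ′ →
    Γ″ ≐ Γ′ , a ⦂ A , b ⦂ B →
    Δ ⨾ Γ ⊢ s ⦂ A ⊗ B →
    Δ ⨾ Γ″ ⊢ t ⦂ C →
    Δ ⨾ Γ₀ ⊢ t [⟨ a , b ⟩≔ s ] ⦂ C

  ⊢par : ∀ {Γ Γ″ t a b A B} →
    Γ″ ≐ Γ , a ⦂ A , b ⦂ B →
    Δ ⨾ Γ″ ⊢ t ⦂ 𝐛𝐨𝐭 →
    Δ ⨾ Γ ⊢ ℘⟨ a , b ⟩ t ⦂ A ⊥ ⅋ B ⊥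

  ⊢appˡ : ∀ {Γ₀ Γ Γ′ t s A B} →
    Γ₀ ≐ Γ ⊎ Γ′ →
    Δ ⨾ Γ ⊢ t ⦂ A ⅋ B →
    Δ ⨾ Γ′ ⊢ s ⦂ A ⊥ →
    Δ ⨾ Γ₀ ⊢ t • s ⦂ B

  ⊢appʳ : ∀ {Γ₀ Γ Γ′ t s A B} →
    Γ₀ ≐ Γ ⊎ Γ′ →
    Δ ⨾ Γ ⊢ t ⦂ A ⅋ B →
    Δ ⨾ Γ′ ⊢ s ⦂ B ⊥ →
    Δ ⨾ Γ₀ ⊢ t ▾ s ⦂ A

  ⊢bang : ∀ {t a A} →
    Δ ⨾ [ a ⦂ A ] ⊢ t ⦂ 𝐛𝐨𝐭 →
    Δ ⨾ ∅ ⊢ !⟨ a ⟩ t ⦂ ‼ (A ⊥)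

  ⊢letbang : ∀ {Δ′ Γ₀ Γ Γ′ t s u A B} →
    Γ₀ ≐ Γ ⊎ Γ′ →
    Δ′ ≐ Δ , u ⦂ A →
    Δ ⨾ Γ ⊢ s ⦂ ‼ A →
    Δ′ ⨾ Γ′ ⊢ t ⦂ B →
    Δ ⨾ Γ₀ ⊢ t [! u ≔ s ] ⦂ B

  ⊢whynot : ∀ {Δ′ Γ t u A} →
    Δ′ ≐ Δ , u ⦂ A ⊥ →
    Δ′ ⨾ Γ ⊢ t ⦂ 𝐛𝐨𝐭 →
    Δ ⨾ Γ ⊢ ?⟨ u ⟩ t ⦂ ⁇ A

  ⊢linsub : ∀ {Γ t s a A} →
    Δ ⨾ Γ ⊢ s ⦂ ⁇ A →
    Δ ⨾ [ a ⦂ A ] ⊢ t ⦂ 𝐛𝐨𝐭 →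
    Δ ⨾ Γ ⊢ t ▶⟨ a ⟩ s ⦂ 𝐛𝐨𝐭

  ⊢contra : ∀ {Γ₀ Γ Γ′ t s B} →
    Γ₀ ≐ Γ ⊎ Γ′ →
    Δ ⨾ Γ ⊢ t ⦂ B →
    Δ ⨾ Γ′ ⊢ s ⦂ B ⊥ →
    Δ ⨾ Γ₀ ⊢ t ♯ s ⦂ 𝐛𝐨𝐭

  ⊢star :
    Δ ⨾ ∅ ⊢ ⋆ ⦂ 𝟏

  ⊢letstar : ∀ {Γ₀ Γ Γ′ t s A} →
    Γ₀ ≐ Γ ⊎ Γ′ →
    Δ ⨾ Γ ⊢ s ⦂ 𝟏 →
    Δ ⨾ Γ′ ⊢ t ⦂ A →
    Δ ⨾ Γ₀ ⊢ t [⋆≔ s ] ⦂ A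

{-# OPTIONS --safe #-}

-- Soundness is an induction on typing: the linear hypotheses and the conclusion
-- form a sequent, and the unrestricted hypotheses, shared by the premises of
-- each rule, are merged by contraction.
--
-- Completeness reduces to interpreting a derivation of ⊢ Γ as a term of type
-- 𝐛𝐨𝐭 in the context Γ ⊥: from a : A ⊥ , Γ ⊢ t : 𝐛𝐨𝐭 the term
-- (℘(a,b). t[⋆:=b]) ▾ ⋆ has type A in context Γ, so the conclusion of the sequent
-- may be chosen freely, and every substitution of s for a in t can be replaced
-- by the contradiction of s with this term.
module Submission where

open import Defs
import Algebra.Solver.CommutativeMonoid as CommutativeMonoidSolver
open import Data.List using (List; []; _∷_; _++_; map)
import Data.List.Extrema.Nat as Extrema
open import Data.List.Membership.Propositional using (_∈_)
open import Data.List.Membership.Propositional.Properties using (∈-∃++; ∈-map⁺; ∈-map⁻; ∈-++⁺ˡ)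
open import Data.List.Properties using (map-++; map-∘; ++-identityʳ; ∷-injective)
open import Data.List.Relation.Binary.Permutation.Propositional
  using (_↭_; ↭-refl; ↭-sym; ↭-trans; ↭-reflexive; prep; swap; ↭⇒↭ₛ)
open import Data.List.Relation.Binary.Permutation.Propositional.Properties
  using (map⁺; ++⁺ˡ; ++⁺ʳ; ++-comm; shift; ∈-resp-↭; ↭-map-inv;
         ↭-empty-inv; ↭-singleton-inv; ++-commutativeMonoid)
import Data.List.Relation.Binary.Permutation.Setoid.Properties as Permutationₛ
import Data.List.Relation.Unary.All as All
open All using ([]; _∷_)
import Data.List.Relation.Unary.All.Properties as All
open import Data.List.Relation.Unary.AllPairs using (AllPairs; []; _∷_)
open import Data.List.Relation.Unary.Any using (here; there)
open import Data.List.Relation.Unary.Unique.Propositional using (Unique)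
open import Data.Nat using (ℕ; suc; s≤s)
open import Data.Nat.Properties using (<⇒≢)
open import Data.Product using (_×_; _,_; ∃-syntax; proj₁; proj₂)
import Data.Vec as Vec
open import Data.Vec using (Vec; toList)
open import Data.Vec.Properties using (toList-map; map-proj₂-zip)
open import Relation.Binary.PropositionalEquality
  using (_≡_; _≢_; refl; sym; trans; cong; cong₂; subst; setoid; ≢-sym)

⊥-involutive : {At : Set} (A : Formula At) → A ⊥ ⊥ ≡ A
⊥-involutive (atom α)  = refl
⊥-involutive (natom α) = refl
⊥-involutive (A ⊗ B)   = cong₂ _⊗_ (⊥-involutive A) (⊥-involutive B)
⊥-involutive (A ⅋ B)   = cong₂ _⅋_ (⊥-involutive A) (⊥-involutive B)
⊥-involutive 𝟏         = refl
⊥-involutive 𝐛𝐨𝐭       = refl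
⊥-involutive (‼ A)     = cong ‼_ (⊥-involutive A)
⊥-involutive (⁇ A)     = cong ⁇_ (⊥-involutive A)

map-++⁻ : ∀ {X Y : Set} {f : X → Y} ys {ys′} xs → map f xs ≡ ys ++ ys′ →
  ∃[ xs₁ ] ∃[ xs₂ ] xs ≡ xs₁ ++ xs₂ × map f xs₁ ≡ ys × map f xs₂ ≡ ys′
map-++⁻ []       xs       e = [] , xs , refl , refl , e
map-++⁻ (y ∷ ys) (x ∷ xs) e
  with refl , e′ ← ∷-injective e
  with xs₁ , xs₂ , refl , e₁ , e₂ ← map-++⁻ ys xs e′
  = x ∷ xs₁ , xs₂ , refl , cong (_ ∷_) e₁ , e₂

AllPairs-++⁻ : ∀ {X : Set} {R : X → X → Set} xs {ys} →
  AllPairs R (xs ++ ys) → AllPairs R xs × AllPairs R ys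
AllPairs-++⁻ []       rs       = [] , rs
AllPairs-++⁻ (x ∷ xs) (r ∷ rs) with ps , qs ← AllPairs-++⁻ xs rs =
  All.++⁻ˡ xs r ∷ ps , qs

module _ {At : Set} where

  open CommutativeMonoidSolver (++-commutativeMonoid {A = Formula At})
    using (solve; _⊜_; _⊕_)

  -- Soundness: from typing derivations to sequent derivations.

  neg : ∀ {V} → Env V At → List (Formula At)
  neg γ = map _⊥ (formulae γ)

  neg? : ∀ {V} → Env V At → List (Formula At)
  neg? δ = map (λ B → ⁇ (B ⊥)) (formulae δ)

  neg-⊎ : ∀ {V} {γ₀ γ γ′ : Env V At} → γ₀ ≐ γ ⊎ γ′ → neg γ₀ ↭ neg γ ++ neg γ′
  neg-⊎ {γ = γ} {γ′} p = ↭-trans (map⁺ _⊥ (map⁺ proj₂ p)) (↭-reflexive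
    (trans (cong (map _⊥) (map-++ proj₂ (bindings γ) (bindings γ′)))
           (map-++ _⊥ (formulae γ) (formulae γ′))))

  -- The two copies of `⁇ B` are brought together and contracted; the survivor joins the side
  -- context for the recursive call.
  contract-all : ∀ Θ {Γ : List (Formula At)} →
    ⊢ map ⁇_ Θ ++ map ⁇_ Θ ++ Γ → ⊢ map ⁇_ Θ ++ Γ
  contract-all []          d = d
  contract-all (B ∷ Θ) {Γ} d =
    exch (shift (⁇ B) (map ⁇_ Θ) Γ)
      (contract-all Θ
        (exch (solve 3 (λ x y z → x ⊕ y ⊕ y ⊕ z ⊜ y ⊕ y ⊕ x ⊕ z) ↭-refl (⁇ B ∷ []) (map ⁇_ Θ) Γ)
          (contraction
            (exch (prep _ (shift (⁇ B) (map ⁇_ Θ) (map ⁇_ Θ ++ Γ))) d))))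

  weaken-all : ∀ Θ {Γ : List (Formula At)} → ⊢ Γ → ⊢ map (λ B → ⁇ (B ⊥)) Θ ++ Γ
  weaken-all []      d = d
  weaken-all (_ ∷ Θ) d = weakening (weaken-all Θ d)

  -- Typing rules share `δ` between their premises, whereas `cut` and `tensor` concatenate contexts;
  -- contraction reconciles the two.
  merge : ∀ (δ : Env UVar At) Γ Γ′ →
    ⊢ (Γ ++ neg? δ) ++ Γ′ ++ neg? δ → ⊢ (Γ ++ Γ′) ++ neg? δ
  merge δ Γ Γ′ d rewrite map-∘ {g = ⁇_} {f = _⊥} (formulae δ) =
    exch (++-comm Ξ (Γ ++ Γ′)) (contract-all (neg δ)
      (exch (solve 3 (λ x y z → (x ⊕ z) ⊕ y ⊕ z ⊜ z ⊕ z ⊕ x ⊕ y) ↭-refl Γ Γ′ Ξ) d))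
    where
    Ξ = map ⁇_ (neg δ)

  -- `𝐛𝐨𝐭` is `𝟏 ⊥`, so a cut against `one` erases it.
  cut-bottom : ∀ {Γ : List (Formula At)} → ⊢ 𝐛𝐨𝐭 ∷ Γ → ⊢ Γ
  cut-bottom d = cut one d

  cut-shared : ∀ (δ : Env UVar At) Γ Γ′ {A} →
    ⊢ A ∷ Γ ++ neg? δ → ⊢ A ⊥ ∷ Γ′ ++ neg? δ → ⊢ (Γ ++ Γ′) ++ neg? δ
  cut-shared δ Γ Γ′ d e = merge δ Γ Γ′ (cut d e)

  -- The cut partner `A ⊥ ⊗ B ⊥` is assembled from the second premise and an axiom on `B`, whose
  -- leftover `B` becomes the conclusion.
  cut-parˡ : ∀ {Γ Γ′ : List (Formula At)} {A B} →
    ⊢ A ⅋ B ∷ Γ → ⊢ A ⊥ ∷ Γ′ → ⊢ B ∷ Γ ++ Γ′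
  cut-parˡ {Γ} {Γ′} {A} {B} d e =
    exch (solve 3 (λ x y z → x ⊕ y ⊕ z ⊜ z ⊕ x ⊕ y) ↭-refl Γ Γ′ (B ∷ []))
      (cut d (tensor e (exch (swap _ _ ↭-refl) (ax {A = B}))))

  cut-parʳ : ∀ {Γ Γ′ : List (Formula At)} {A B} →
    ⊢ A ⅋ B ∷ Γ → ⊢ B ⊥ ∷ Γ′ → ⊢ A ∷ Γ ++ Γ′
  cut-parʳ {Γ} {Γ′} {A} {B} d e =
    exch (shift A Γ Γ′)
      (cut d (tensor (exch (swap _ _ ↭-refl) (ax {A = A})) e))

  promotion-neg : ∀ (δ : Env UVar At) {A} → ⊢ A ∷ neg? δ → ⊢ ‼ A ∷ neg? δ
  promotion-neg δ d rewrite map-∘ {g = ⁇_} {f = _⊥} (formulae δ) = promotion d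

  -- Dereliction turns the axiom on `A` into `A , ⁇ (A ⊥)`; the rest of `Δ` is weakened in.
  hypothesis : ∀ {Δ : List (Formula At)} {A} → A ∈ Δ → ⊢ A ∷ map (λ B → ⁇ (B ⊥)) Δ
  hypothesis {A = A} A∈Δ with Δ₁ , Δ₂ , refl ← ∈-∃++ A∈Δ =
    exch (↭-trans (++-comm (map _ (Δ₁ ++ Δ₂)) _)
                  (↭-trans (swap _ _ ↭-refl)
                           (prep A (↭-sym (map⁺ _ (shift A Δ₁ Δ₂))))))
      (weaken-all (Δ₁ ++ Δ₂) (dereliction (exch (swap _ _ ↭-refl) (ax {A = A}))))

  join : ∀ {V} {γ₀ γ γ′ : Env V At} {A Ξ} → γ₀ ≐ γ ⊎ γ′ →
    ⊢ A ∷ (neg γ ++ neg γ′) ++ Ξ → ⊢ A ∷ neg γ₀ ++ Ξ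
  join {γ₀ = γ₀} {γ} {γ′} p =
    exch (prep _ (++⁺ʳ _ (↭-sym (neg-⊎ {γ₀ = γ₀} {γ} {γ′} p))))

  soundness : ∀ {Δ : Env UVar At} {Γ t A} → Δ ⨾ Γ ⊢ t ⦂ A → ⊢ A ∷ neg Γ ++ neg? Δ
  soundness {Δ} (⊢lvar {A = A}) =
    exch (++-comm (neg? Δ) _) (weaken-all (formulae Δ) ax)
  soundness (⊢uvar u∈Δ) = hypothesis (∈-map⁺ proj₂ u∈Δ)
  soundness {Δ} (⊢pair {Γ₀} {Γ} {Γ′} {A = A} {B} p d e) =
    join {γ₀ = Γ₀} {Γ} {Γ′} p
      (merge Δ (A ⊗ B ∷ neg Γ) (neg Γ′) (tensor (soundness d) (soundness e)))
  soundness {Δ} (⊢letpair {Γ₀} {Γ} {Γ′} {A = A} {B} {C} p q d e) =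
    join {γ₀ = Γ₀} {Γ} {Γ′} p (exch (++⁺ʳ _ (shift C (neg Γ) (neg Γ′)))
      (cut-shared Δ (neg Γ) (C ∷ neg Γ′) (soundness d)
        (par (exch (↭-trans (prep C (++⁺ʳ _ (map⁺ _⊥ (map⁺ proj₂ q))))
                            (↭-trans (swap _ _ ↭-refl) (prep _ (swap _ _ ↭-refl))))
                   (soundness e)))))
  soundness (⊢par q d) =
    par (cut-bottom (exch (prep _ (++⁺ʳ _ (map⁺ _⊥ (map⁺ proj₂ q)))) (soundness d)))
  soundness {Δ} (⊢appˡ {Γ₀} {Γ} {Γ′} {B = B} p d e) =
    join {γ₀ = Γ₀} {Γ} {Γ′} p
      (merge Δ (B ∷ neg Γ) (neg Γ′) (cut-parˡ (soundness d) (soundness e)))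
  soundness {Δ} (⊢appʳ {Γ₀} {Γ} {Γ′} {A = A} p d e) =
    join {γ₀ = Γ₀} {Γ} {Γ′} p
      (merge Δ (A ∷ neg Γ) (neg Γ′) (cut-parʳ (soundness d) (soundness e)))
  soundness {Δ} (⊢bang d) = promotion-neg Δ (cut-bottom (soundness d))
  -- The variable `u : A` contributes `⁇ (A ⊥)`, which is `(‼ A) ⊥`, so it is cut directly against
  -- the premise for `s`.
  soundness {Δ} (⊢letbang {Δ′} {Γ₀} {Γ} {Γ′} {B = B} p q d e) =
    join {γ₀ = Γ₀} {Γ} {Γ′} p (exch (++⁺ʳ _ (shift B (neg Γ) (neg Γ′)))
      (cut-shared Δ (neg Γ) (B ∷ neg Γ′) (soundness d)
        (exch (↭-trans (++⁺ˡ (B ∷ neg Γ′) (map⁺ _ (map⁺ proj₂ q)))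
                       (shift _ (B ∷ neg Γ′) (neg? Δ)))
              (soundness e))))
  soundness {Δ} (⊢whynot {Γ = Γ} {A = A} q d) =
    exch (↭-trans (++⁺ˡ (neg Γ) (map⁺ _ (map⁺ proj₂ q)))
           (↭-trans (shift _ (neg Γ) (neg? Δ))
                    (↭-reflexive (cong (λ C → ⁇ C ∷ neg Γ ++ neg? Δ) (⊥-involutive A)))))
      (cut-bottom (soundness d))
  -- The body yields `A ⊥` with only unrestricted hypotheses beside it, so promotion applies and
  -- gives `‼ (A ⊥)`, the dual of `⁇ A`.
  soundness {Δ} (⊢linsub {Γ} {A = A} d e) =
    bottom (subst (λ Ξ → ⊢ Ξ ++ neg? Δ) (++-identityʳ (neg Γ))
      (cut-shared Δ (neg Γ) [] (soundness d) (promotion-neg Δ (cut-bottom (soundness e)))))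
  soundness {Δ} (⊢contra {Γ₀} {Γ} {Γ′} p d e) =
    join {γ₀ = Γ₀} {Γ} {Γ′} p
      (bottom (cut-shared Δ (neg Γ) (neg Γ′) (soundness d) (soundness e)))
  soundness {Δ} ⊢star = exch (++-comm (neg? Δ) _) (weaken-all (formulae Δ) one)
  soundness {Δ} (⊢letstar {Γ₀} {Γ} {Γ′} {A = A} p d e) =
    join {γ₀ = Γ₀} {Γ} {Γ′} p (exch (++⁺ʳ _ (shift A (neg Γ) (neg Γ′)))
      (cut-shared Δ (neg Γ) (A ∷ neg Γ′) (soundness d) (bottom (soundness e))))

  -- Typing rules for anonymous hypotheses.

  fresh : ∀ xs → ∃[ x ] All.All (x ≢_) xs
  fresh xs = suc (Extrema.max 0 xs) , All.map (λ x≤m → ≢-sym (<⇒≢ (s≤s x≤m))) (Extrema.xs≤max 0 xs)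

  extend : (γ : Env ℕ At) (A : Formula At) →
    ∃[ x ] ∃[ γ′ ] bindings γ′ ≡ (x , A) ∷ bindings γ
  extend γ A with x , x∉ ← fresh (map proj₁ (bindings γ)) =
    x , env ((x , A) ∷ bindings γ) (x∉ ∷ distinct γ) , refl

  -- Typability with the names forgotten: the hypotheses may be named at will.
  infix 4 _∣_⊩_

  _∣_⊩_ : List (Formula At) → List (Formula At) → Formula At → Set
  Δ ∣ Γ ⊩ A = ∀ (δ : Env UVar At) (γ : Env LVar At) →
    formulae δ ↭ Δ → formulae γ ↭ Γ → ∃[ t ] (δ ⨾ γ ⊢ t ⦂ A)

  -- The permutation of formulae lifts along `proj₂` to one of bindings, which is cut where `Γ`
  -- ends. Both halves inherit distinct names from `γ₀`.
  split : ∀ {V} Γ Γ′ (γ₀ : Env V At) → formulae γ₀ ↭ Γ ++ Γ′ →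
    ∃[ γ ] ∃[ γ′ ] (γ₀ ≐ γ ⊎ γ′) × formulae γ ↭ Γ × formulae γ′ ↭ Γ′
  split {V} Γ Γ′ γ₀ p
    with bs , eq , q ← ↭-map-inv proj₂ p
    with bs₁ , bs₂ , refl , eq₁ , eq₂ ← map-++⁻ Γ bs (sym eq)
    with u₁ , u₂ ← AllPairs-++⁻ (map proj₁ bs₁)
           (subst Unique (map-++ proj₁ bs₁ bs₂)
             (Permutationₛ.Unique-resp-↭ (setoid V) (↭⇒↭ₛ (map⁺ proj₁ q)) (distinct γ₀)))
    = env bs₁ u₁ , env bs₂ u₂ , q , ↭-reflexive eq₁ , ↭-reflexive eq₂

  exchange : ∀ {Δ Γ Γ′ A} → Γ ↭ Γ′ → Δ ∣ Γ ⊩ A → Δ ∣ Γ′ ⊩ A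
  exchange p f δ γ r s = f δ γ r (↭-trans s (↭-sym p))

  ⊩-lvar : ∀ {Δ A} → Δ ∣ A ∷ [] ⊩ A
  ⊩-lvar {A = A} δ γ r s = go γ (↭-singleton-inv s)
    where
    go : (γ : Env LVar At) → formulae γ ≡ A ∷ [] → ∃[ t ] (δ ⨾ γ ⊢ t ⦂ A)
    go (env ((a , _) ∷ []) ([] ∷ [])) refl = lfree a , ⊢lvar

  closed : ∀ {δ : Env UVar At} {A t} → δ ⨾ ∅ ⊢ t ⦂ A →
    (γ : Env LVar At) → formulae γ ↭ [] → ∃[ t ] (δ ⨾ γ ⊢ t ⦂ A)
  closed {δ} {A} {t} d γ s = go γ (↭-empty-inv s)
    where
    go : (γ : Env LVar At) → formulae γ ≡ [] → ∃[ t ] (δ ⨾ γ ⊢ t ⦂ A)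
    go (env [] []) refl = t , d

  ⊩-uvar : ∀ {Δ A} → A ∈ Δ → Δ ∣ [] ⊩ A
  ⊩-uvar A∈Δ δ γ r s
    with (u , _) , u∈δ , refl ← ∈-map⁻ proj₂ (∈-resp-↭ (↭-sym r) A∈Δ)
    = closed (⊢uvar u∈δ) γ s

  ⊩-pair : ∀ {Δ Γ Γ′ A B} → Δ ∣ Γ ⊩ A → Δ ∣ Γ′ ⊩ B → Δ ∣ Γ ++ Γ′ ⊩ A ⊗ B
  ⊩-pair f g δ γ₀ r s
    with γ , γ′ , p , q , q′ ← split _ _ γ₀ s
    with _ , d ← f δ γ r q
    with _ , e ← g δ γ′ r q′
    = _ , ⊢pair p d e

  ⊩-letpair : ∀ {Δ Γ Γ′ A B C} →
    Δ ∣ Γ ⊩ A ⊗ B → Δ ∣ A ∷ B ∷ Γ′ ⊩ C → Δ ∣ Γ ++ Γ′ ⊩ C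
  ⊩-letpair {A = A} {B} f g δ γ₀ r s
    with γ , γ′ , p , q , q′ ← split _ _ γ₀ s
    with _ , d ← f δ γ r q
    with b , γ₁ , eq₁ ← extend γ′ B
    -- Being fresh for `γ₁`, which already declares `b`, the name `a` differs from `b`.
    with a , γ₂ , eq₂ ← extend γ₁ A
    with γ₂≡ ← trans eq₂ (cong (_ ∷_) eq₁)
    with _ , e ← g δ γ₂ r (↭-trans (↭-reflexive (cong (map proj₂) γ₂≡)) (prep _ (prep _ q′)))
    = _ , ⊢letpair {Γ′ = γ′} {a = a} {b} p (↭-reflexive γ₂≡) d e

  ⊩-par : ∀ {Δ Γ A B} → Δ ∣ A ∷ B ∷ Γ ⊩ 𝐛𝐨𝐭 → Δ ∣ Γ ⊩ A ⊥ ⅋ B ⊥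
  ⊩-par {A = A} {B} f δ γ r s
    with b , γ₁ , eq₁ ← extend γ B
    with a , γ₂ , eq₂ ← extend γ₁ A
    with γ₂≡ ← trans eq₂ (cong (_ ∷_) eq₁)
    with _ , d ← f δ γ₂ r (↭-trans (↭-reflexive (cong (map proj₂) γ₂≡)) (prep _ (prep _ s)))
    = _ , ⊢par {a = a} {b} (↭-reflexive γ₂≡) d

  ⊩-appʳ : ∀ {Δ Γ Γ′ A B} → Δ ∣ Γ ⊩ A ⅋ B → Δ ∣ Γ′ ⊩ B ⊥ → Δ ∣ Γ ++ Γ′ ⊩ A
  ⊩-appʳ f g δ γ₀ r s
    with γ , γ′ , p , q , q′ ← split _ _ γ₀ s
    with _ , d ← f δ γ r q
    with _ , e ← g δ γ′ r q′
    = _ , ⊢appʳ p d e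

  ⊩-bang : ∀ {Δ A} → Δ ∣ A ∷ [] ⊩ 𝐛𝐨𝐭 → Δ ∣ [] ⊩ ‼ (A ⊥)
  ⊩-bang {A = A} f δ γ r s
    -- The body has a single linear hypothesis, so any name is fresh.
    with _ , d ← f δ [ 0 ⦂ A ] r ↭-refl
    = closed (⊢bang d) γ s

  ⊩-letbang : ∀ {Δ Γ Γ′ A B} → Δ ∣ Γ ⊩ ‼ A → A ∷ Δ ∣ Γ′ ⊩ B → Δ ∣ Γ ++ Γ′ ⊩ B
  ⊩-letbang {A = A} f g δ γ₀ r s
    with γ , γ′ , p , q , q′ ← split _ _ γ₀ s
    with _ , d ← f δ γ r q
    with u , δ′ , eq ← extend δ A
    with _ , e ← g δ′ γ′ (↭-trans (↭-reflexive (cong (map proj₂) eq)) (prep _ r)) q′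
    = _ , ⊢letbang {u = u} p (↭-reflexive eq) d e

  ⊩-linsub : ∀ {Δ Γ A} → Δ ∣ Γ ⊩ ⁇ A → Δ ∣ A ∷ [] ⊩ 𝐛𝐨𝐭 → Δ ∣ Γ ⊩ 𝐛𝐨𝐭
  ⊩-linsub {A = A} f g δ γ r s
    with _ , d ← f δ γ r s
    with _ , e ← g δ [ 0 ⦂ A ] r ↭-refl
    = _ , ⊢linsub d e

  ⊩-contra : ∀ {Δ Γ Γ′ A} → Δ ∣ Γ ⊩ A → Δ ∣ Γ′ ⊩ A ⊥ → Δ ∣ Γ ++ Γ′ ⊩ 𝐛𝐨𝐭
  ⊩-contra f g δ γ₀ r s
    with γ , γ′ , p , q , q′ ← split _ _ γ₀ s
    with _ , d ← f δ γ r q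
    with _ , e ← g δ γ′ r q′
    = _ , ⊢contra p d e

  ⊩-star : ∀ {Δ} → Δ ∣ [] ⊩ 𝟏
  ⊩-star δ γ r s = closed ⊢star γ s

  ⊩-letstar : ∀ {Δ Γ Γ′ A} → Δ ∣ Γ ⊩ 𝟏 → Δ ∣ Γ′ ⊩ A → Δ ∣ Γ ++ Γ′ ⊩ A
  ⊩-letstar f g δ γ₀ r s
    with γ , γ′ , p , q , q′ ← split _ _ γ₀ s
    with _ , d ← f δ γ r q
    with _ , e ← g δ γ′ r q′
    = _ , ⊢letstar p d e

  -- Reasoning by contradiction and moving hypotheses between the two zones.

  -- A dummy hypothesis `𝟏` is added so that the par binder has a second variable; the resulting
  -- `A ⊥ ⅋ 𝐛𝐨𝐭` is then applied to `⋆`.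
  ⊩-refute : ∀ {Δ Γ A} → Δ ∣ A ∷ Γ ⊩ 𝐛𝐨𝐭 → Δ ∣ Γ ⊩ A ⊥
  ⊩-refute {Γ = Γ} f =
    exchange (↭-reflexive (++-identityʳ Γ))
      (⊩-appʳ (⊩-par (exchange (swap _ _ ↭-refl) (⊩-letstar ⊩-lvar f))) ⊩-star)

  ⊩-raa : ∀ {Δ Γ A} → Δ ∣ A ⊥ ∷ Γ ⊩ 𝐛𝐨𝐭 → Δ ∣ Γ ⊩ A
  ⊩-raa {Δ} {Γ} {A} f = subst (Δ ∣ Γ ⊩_) (⊥-involutive A) (⊩-refute f)

  ⊩-cut : ∀ {Δ Γ Γ′ A} → Δ ∣ Γ ⊩ A → Δ ∣ A ∷ Γ′ ⊩ 𝐛𝐨𝐭 → Δ ∣ Γ ++ Γ′ ⊩ 𝐛𝐨𝐭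
  ⊩-cut f g = ⊩-contra f (⊩-refute g)

  -- The witness is `!⟨ a ⟩ (u ♯ a)` with `a : A ⊥`, typed up to double negation.
  ⊩-box : ∀ {Δ A} → A ∈ Δ → Δ ∣ [] ⊩ ‼ A
  ⊩-box {Δ} {A} A∈Δ =
    subst (λ B → Δ ∣ [] ⊩ ‼ B) (⊥-involutive A)
      (⊩-bang (⊩-contra (⊩-uvar A∈Δ) ⊩-lvar))

  -- Each linear `‼ B` is opened by a `letbang`, which supplies the unrestricted `B`.
  store : ∀ Θ {Δ Γ A} → Θ ++ Δ ∣ Γ ⊩ A → Δ ∣ map ‼_ Θ ++ Γ ⊩ A
  store []              f = f
  store (B ∷ Θ) {Γ = Γ} f =
    exchange (shift (‼ B) (map ‼_ Θ) Γ) (store Θ (⊩-letbang ⊩-lvar f))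

  -- Each linear `‼ B` is cut against a box around an unrestricted variable. Only membership is
  -- required, so repeated formulae may share one variable.
  unstore : ∀ {Θ Δ Γ} → All.All (_∈ Δ) Θ → Δ ∣ map ‼_ Θ ++ Γ ⊩ 𝐛𝐨𝐭 → Δ ∣ Γ ⊩ 𝐛𝐨𝐭
  unstore []          f = f
  unstore (B∈Δ ∷ Θ⊆Δ) f = unstore Θ⊆Δ (⊩-cut (⊩-box B∈Δ) f)

  -- Completeness: from sequent derivations to terms.

  ⊥-map-⁇ : (Γ : List (Formula At)) → map _⊥ (map ⁇_ Γ) ≡ map ‼_ (map _⊥ Γ)
  ⊥-map-⁇ Γ = trans (sym (map-∘ Γ)) (map-∘ Γ)

  -- Quantifying over `Δ` inside the induction lets the exponential rules call the hypothesis with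
  -- more unrestricted variables.
  refutation : ∀ {Γ} → ⊢ Γ → ∀ Δ → Δ ∣ map _⊥ Γ ⊩ 𝐛𝐨𝐭
  refutation (exch p d) Δ = exchange (map⁺ _⊥ p) (refutation d Δ)
  refutation ax Δ = ⊩-contra ⊩-lvar ⊩-lvar
  refutation (cut {Γ} {Γ′} d e) Δ rewrite map-++ _⊥ Γ Γ′ =
    ⊩-contra (⊩-raa (refutation d Δ)) (⊩-raa (refutation e Δ))
  refutation (tensor {Γ} {Γ′} d e) Δ rewrite map-++ _⊥ Γ Γ′ =
    exchange (++-comm (map _⊥ Γ ++ map _⊥ Γ′) _)
      (⊩-contra (⊩-pair (⊩-raa (refutation d Δ)) (⊩-raa (refutation e Δ))) ⊩-lvar)
  refutation (par d) Δ = ⊩-letpair ⊩-lvar (refutation d Δ)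
  refutation one Δ = ⊩-lvar
  refutation (bottom d) Δ = ⊩-letstar ⊩-lvar (refutation d Δ)
  -- The body of `linsub` admits one linear variable only. Hence the hypotheses `‼ (B ⊥)` are first
  -- stored as unrestricted ones, then recovered as boxes inside the body.
  refutation (promotion {Γ} {A} d) Δ
    with f ← refutation d (map _⊥ Γ ++ Δ)
    rewrite ⊥-map-⁇ Γ =
    exchange (++-comm (map ‼_ (map _⊥ Γ)) _)
      (store (map _⊥ Γ) (⊩-linsub ⊩-lvar
        (unstore (All.tabulate (∈-++⁺ˡ {xs = map _⊥ Γ}))
          (exchange (++-comm (A ⊥ ∷ []) _) f))))
  -- In the three structural rules `‼ (A ⊥)` is opened as an unrestricted variable, which is then
  -- used never, once, or in two boxes.
  refutation (weakening d) Δ = ⊩-letbang ⊩-lvar (refutation d (_ ∷ Δ))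
  refutation (dereliction d) Δ =
    ⊩-letbang ⊩-lvar (⊩-cut (⊩-uvar (here refl)) (refutation d (_ ∷ Δ)))
  refutation (contraction d) Δ =
    ⊩-letbang ⊩-lvar (unstore (here refl ∷ here refl ∷ []) (refutation d (_ ∷ Δ)))

  formulae-declare : ∀ {V : Set} {n} (xs : Vec V n) (u : Unique (toList xs)) (As : Vec (Formula At) n) →
    formulae (declare xs u As) ≡ toList As
  formulae-declare xs u As =
    trans (sym (toList-map proj₂ (Vec.zip xs As))) (cong toList (map-proj₂-zip xs As))

  -- The chosen conclusion is moved to the front of the sequent, so that its negation is the
  -- hypothesis discharged by `⊩-raa`.
  completeness : ∀ {Γ₀ : List (Formula At)} {n} (Γ : Vec (Formula At) n) {A} →
    ⊢ Γ₀ → toList Γ ++ A ∷ [] ↭ Γ₀ →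
    (a : Vec LVar n) (distinct-a : Unique (toList a)) →
    ∃[ t ] (∅ ⨾ declare a distinct-a (Vec.map _⊥ Γ) ⊢ t ⦂ A)
  completeness Γ {A} d p a u =
    ⊩-raa (refutation (exch (↭-trans (↭-sym p) (++-comm (toList Γ) (A ∷ []))) d) [])
      ∅ (declare a u (Vec.map _⊥ Γ)) ↭-refl
      (↭-reflexive (trans (formulae-declare a u (Vec.map _⊥ Γ)) (toList-map _⊥ Γ)))

lemma9 : (At : Set) →
    (∀ (Δ : Env UVar At) (Γ : Env LVar At) (t : Term) (A : Formula At) →
    Δ ⨾ Γ ⊢ t ⦂ A →
    ⊢ map (λ B → ⁇ (B ⊥)) (formulae Δ) ++ map _⊥ (formulae Γ) ++ A ∷ [])
    ×
    (∀ (Γ₀ : List (Formula At)) → ⊢ Γ₀ →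
    ∀ (n : ℕ) (Γ : Vec (Formula At) n) (A : Formula At) →
    toList Γ ++ A ∷ [] ↭ Γ₀ →
    ∀ (a : Vec LVar n) (distinct-a : Unique (toList a)) →
    ∃[ t ] (∅ ⨾ declare a distinct-a (Vec.map _⊥ Γ) ⊢ t ⦂ A))
lemma9 At =
  (λ Δ Γ t A d →
    exch (↭-trans (++-comm (A ∷ neg Γ) (neg? Δ)) (++⁺ˡ (neg? Δ) (++-comm (A ∷ []) (neg Γ))))
      (soundness d)) ,
  (λ Γ₀ d n Γ A p a u → completeness Γ d p a u)
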